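{- Let $k\ge1$. For a coloring matrix $A$, let $\widehat{A}$ (the blowup of $A$) be the block matrix obtained by replacing every entry $1$ of $A$ by the $k\times k$ all-ones matrix and every entry $0$ by the $k\times k$ all-zeros matrix. If $A$ and $B$ are tree coloring equivalent, then so are $\widehat{A}$ and $\widehat{B}$; and if $A$ and $B$ are strictly tree coloring equivalent, then so are $\widehat{A}$ and $\widehat{B}$. Moreover, $t_{\widehat{A}}(n)=k^n t_A(n)$ for all $n\ge1$.
   Context: A plane tree is an unlabeled rooted tree in which the children of every vertex are linearly ordered. A coloring matrix is an $m\times m$ matrix $A=(a_{ij})$ with entries in $\{0,1\}$. An $A$-coloring of a plane tree assigns to each vertex a color in $\{1,\dots,m\}$ such that whenever a vertex of color $j$ is a child of a vertex of color $i$, $a_{ij}=1$. Let $t_A(n)$ be the number of pairs (plane tree with $n$ vertices, $A$-coloring of it) and $t_A^{(i)}(n)$ the number of those with root color $i$. Two coloring matrices $A,B$ of the same size are tree coloring equivalent if $t_A(n)=t_B(n)$ for all $n\ge1$, and strictly tree coloring equivalent if $t_A^{(i)}(n)=t_B^{(i)}(n)$ for all $n\ge1$ and all $i$. -}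

module Defs where

open import Axiom.UniquenessOfIdentityProofs using (module Decidable⇒UIP)
open import Data.Fin using (Fin; zero; suc; quotient; remainder; _≟_)
open import Data.Fin.Patterns using (0F; 1F)
open import Data.Fin.Properties using (+↔⊎; *↔×; 1↔⊤)
open import Data.List using (List; []; _∷_)
open import Data.List.Relation.Unary.All using (All; []; _∷_)
open import Data.Nat using (ℕ; zero; suc; _+_; _*_; _≤_; _<_; s≤s)
open import Data.Nat.Properties using (≤-trans; m≤m+n; m≤n+m; ≤-refl)
open import Data.Product using (Σ; ∃; _×_; _,_; proj₁; proj₂)
open import Data.Product.Function.Dependent.Propositional using (Σ-↔)
open import Data.Product.Function.NonDependent.Propositional using (_×-↔_)
open import Data.Sum using (_⊎_; inj₁; inj₂)
open import Data.Sum.Function.Propositional using (_⊎-↔_)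
open import Data.Unit using (⊤; tt)
open import Function using (_↔_; mk↔ₛ′; Inverse)
open import Function.Properties.Inverse using (↔-sym; ↔-trans; ↔-refl)
open import Relation.Binary.PropositionalEquality using (_≡_; refl)
open import Relation.Nullary using (Dec; yes; no; Irrelevant; contradiction)

data PlaneTree : Set where
  node : List PlaneTree → PlaneTree

mutual
  size : PlaneTree → ℕ
  size (node ts) = suc (sizes ts)

  sizes : List PlaneTree → ℕ
  sizes []       = 0
  sizes (t ∷ ts) = size t + sizes ts

-- Arbitrary assignments of a color to every vertex.
data Coloring (m : ℕ) : PlaneTree → Set where
  node : ∀ {ts} → Fin m → All (Coloring m) ts → Coloring m (node ts)

rootColor : ∀ {m t} → Coloring m t → Fin m
rootColor (node i _) = i

ColoringMatrix : ℕ → Set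
ColoringMatrix m = Fin m → Fin m → Fin 2

mutual
  IsColoring : ∀ {m} → ColoringMatrix m → ∀ {t} → Coloring m t → Set
  IsColoring A (node i cs) = AreChildrenOf A i cs

  -- The colored trees cs may be attached below a vertex of color i.
  AreChildrenOf : ∀ {m} → ColoringMatrix m → Fin m →
                  ∀ {ts} → All (Coloring m) ts → Set
  AreChildrenOf A i []       = ⊤
  AreChildrenOf A i (c ∷ cs) =
    A i (rootColor c) ≡ 1F × IsColoring A c × AreChildrenOf A i cs

ColoredTree : ∀ {m} → ColoringMatrix m → ℕ → Set
ColoredTree {m} A n =
  Σ PlaneTree λ t → size t ≡ n × Σ (Coloring m t) λ c → IsColoring A c

ColoredTreeWithRoot : ∀ {m} → ColoringMatrix m → Fin m → ℕ → Set
ColoredTreeWithRoot {m} A i n =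
  Σ PlaneTree λ t → size t ≡ n ×
    Σ (Coloring m t) λ c → IsColoring A c × rootColor c ≡ i

-- The first component is the cardinality of X.
Finite : Set → Set
Finite X = ∃ λ N → X ↔ Fin N

private
  transport : ∀ {X Y} → X ↔ Y → Finite Y → Finite X
  transport f (N , g) = N , ↔-trans f g

  finite-⊤ : Finite ⊤
  finite-⊤ = 1 , ↔-sym 1↔⊤

  finite-⊎ : ∀ {X Y} → Finite X → Finite Y → Finite (X ⊎ Y)
  finite-⊎ (M , f) (N , g) = M + N , ↔-trans (f ⊎-↔ g) (↔-sym +↔⊎)

  finite-× : ∀ {X Y} → Finite X → Finite Y → Finite (X × Y)
  finite-× (M , f) (N , g) = M * N , ↔-trans (f ×-↔ g) (↔-sym *↔×)

  finite-Dec : ∀ {X : Set} → Dec X → Irrelevant X → Finite X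
  finite-Dec (yes x) irr =
    transport (mk↔ₛ′ (λ _ → tt) (λ _ → x) (λ _ → refl) (irr x)) finite-⊤
  finite-Dec (no ¬x) irr =
    0 , mk↔ₛ′ (λ x → contradiction x ¬x) (λ ()) (λ ()) (λ x → contradiction x ¬x)

  finite-ΣFin : ∀ N {P : Fin N → Set} → (∀ i → Finite (P i)) → Finite (Σ (Fin N) P)
  finite-ΣFin zero    f = 0 , mk↔ₛ′ proj₁ (λ ()) (λ ()) (λ ())
  finite-ΣFin (suc N) {P} f =
    transport split (finite-⊎ (f zero) (finite-ΣFin N (λ i → f (suc i))))
    where
    split : Σ (Fin (suc N)) P ↔ (P zero ⊎ Σ (Fin N) (λ i → P (suc i)))
    split = mk↔ₛ′
      (λ { (zero , p) → inj₁ p ; (suc i , p) → inj₂ (i , p) })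
      (λ { (inj₁ p) → zero , p ; (inj₂ (i , p)) → suc i , p })
      (λ { (inj₁ p) → refl ; (inj₂ (i , p)) → refl })
      (λ { (zero , p) → refl ; (suc i , p) → refl })

  finite-Σ : ∀ {X : Set} {P : X → Set} →
             Finite X → (∀ x → Finite (P x)) → Finite (Σ X P)
  finite-Σ {P = P} (N , f) g =
    transport (↔-sym (Σ-↔ {A = λ i → P (Inverse.from f i)} (↔-sym f) ↔-refl))
              (finite-ΣFin N (λ i → g (Inverse.from f i)))

  Split : ℕ → Set
  Split n = Σ ℕ λ a → Σ ℕ λ b → a + b ≡ n

  finite-Split : ∀ n → Finite (Split n)
  finite-Split zero = transport
    (mk↔ₛ′ (λ _ → tt) (λ _ → 0 , 0 , refl) (λ _ → refl)
           (λ { (zero , zero , refl) → refl }))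
    finite-⊤
  finite-Split (suc n) = transport
    (mk↔ₛ′
      (λ { (zero , b , eq) → inj₁ tt ; (suc a , b , refl) → inj₂ (a , b , refl) })
      (λ { (inj₁ _) → 0 , suc n , refl ; (inj₂ (a , b , refl)) → suc a , b , refl })
      (λ { (inj₁ _) → refl ; (inj₂ (a , b , refl)) → refl })
      (λ { (zero , b , refl) → refl ; (suc a , b , refl) → refl }))
    (finite-⊎ finite-⊤ (finite-Split n))

  module _ {m} (A : ColoringMatrix m) where

    ColoredForest : Fin m → ℕ → Set
    ColoredForest i n =
      Σ (List PlaneTree) λ ts → sizes ts ≡ n ×
        Σ (All (Coloring m) ts) λ cs → AreChildrenOf A i cs

    forest-zero : ∀ i → ColoredForest i 0 ↔ ⊤
    forest-zero i = mk↔ₛ′ (λ _ → tt) (λ _ → [] , refl , [] , tt) (λ _ → refl)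
      (λ { ([] , refl , [] , tt) → refl ; (node _ ∷ _ , () , _) })

    -- A nonempty forest is the root color j of its first tree, the children
    -- of that root, and the remaining trees.
    FirstTree : Fin m → (n : ℕ) → Split n → Set
    FirstTree i n (a , b , _) =
      Σ (Fin m) λ j → A i j ≡ 1F × ColoredForest j a × ColoredForest i b

    forest-suc : ∀ i n → ColoredForest i (suc n) ↔ Σ (Split n) (FirstTree i n)
    forest-suc i n = mk↔ₛ′
      (λ { (node ts ∷ us , refl , node j cs ∷ ds , e , p , q) →
           (sizes ts , sizes us , refl) , j , e , (ts , refl , cs , p) , (us , refl , ds , q) })
      (λ { ((_ , _ , refl) , j , e , (ts , refl , cs , p) , (us , refl , ds , q)) →
           node ts ∷ us , refl , node j cs ∷ ds , e , p , q })
      (λ { ((_ , _ , refl) , j , e , (ts , refl , cs , p) , (us , refl , ds , q)) → refl })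
      (λ { (node ts ∷ us , refl , node j cs ∷ ds , e , p , q) → refl })

    finite-forest : ∀ bound n → n < bound → ∀ i → Finite (ColoredForest i n)
    finite-forest (suc _) zero _ i = transport (forest-zero i) finite-⊤
    finite-forest (suc bound) (suc n) (s≤s n<bound) i =
      transport (forest-suc i n) (finite-Σ (finite-Split n) λ
        { (a , b , refl) → finite-ΣFin m λ j →
            finite-× (finite-Dec (A i j ≟ 1F) (Decidable⇒UIP.≡-irrelevant _≟_))
              (finite-× (finite-forest bound a (≤-trans (s≤s (m≤m+n a b)) n<bound) j)
                        (finite-forest bound b (≤-trans (s≤s (m≤n+m b a)) n<bound) i)) })

finite-ColoredTreeWithRoot :
  ∀ {m} (A : ColoringMatrix m) i n → Finite (ColoredTreeWithRoot A i n)
finite-ColoredTreeWithRoot A i zero =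
  0 , mk↔ₛ′ (λ { (node _ , () , _) }) (λ ()) (λ ()) (λ { (node _ , () , _) })
finite-ColoredTreeWithRoot A i (suc n) = transport
  (mk↔ₛ′
    (λ { (node ts , refl , node j cs , p , refl) → ts , refl , cs , p })
    (λ { (ts , refl , cs , p) → node ts , refl , node i cs , p , refl })
    (λ { (ts , refl , cs , p) → refl })
    (λ { (node ts , refl , node j cs , p , refl) → refl }))
  (finite-forest A (suc n) n ≤-refl i)

finite-ColoredTree : ∀ {m} (A : ColoringMatrix m) n → Finite (ColoredTree A n)
finite-ColoredTree {m} A n = transport
  (mk↔ₛ′
    (λ { (t , e , c , p) → rootColor c , t , e , c , p , refl })
    (λ { (i , t , e , c , p , _) → t , e , c , p })
    (λ { (i , t , e , c , p , refl) → refl })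
    (λ { (t , e , c , p) → refl }))
  (finite-ΣFin m λ i → finite-ColoredTreeWithRoot A i n)

treeCount : ∀ {m} → ColoringMatrix m → ℕ → ℕ
treeCount A n = proj₁ (finite-ColoredTree A n)

treeCountWithRoot : ∀ {m} → ColoringMatrix m → Fin m → ℕ → ℕ
treeCountWithRoot A i n = proj₁ (finite-ColoredTreeWithRoot A i n)

TreeColoringEquivalent : ∀ {m} → ColoringMatrix m → ColoringMatrix m → Set
TreeColoringEquivalent A B = ∀ n → 1 ≤ n → treeCount A n ≡ treeCount B n

StrictlyTreeColoringEquivalent : ∀ {m} → ColoringMatrix m → ColoringMatrix m → Set
StrictlyTreeColoringEquivalent A B =
  ∀ n → 1 ≤ n → ∀ i → treeCountWithRoot A i n ≡ treeCountWithRoot B i n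

zeros ones : ∀ {k} → ColoringMatrix k
zeros _ _ = 0F
ones  _ _ = 1F

block : ∀ {k} → Fin 2 → ColoringMatrix k
block 0F = zeros
block 1F = ones

-- Row p of the block matrix is row (remainder p) inside block row (quotient p),
-- i.e. p = k * quotient p + remainder p when colors are counted from 0.
blowup : ∀ {m} k → ColoringMatrix m → ColoringMatrix (m * k)
blowup {m} k A p q =
  block (A (quotient k p) (quotient k q)) (remainder {m} k p) (remainder {m} k q)

{-# OPTIONS --safe #-}

-- Color (i , r) of the blowup is adjacent to (j , s) exactly when i is adjacent
-- to j.  Hence a coloring for the blowup is a coloring for A together with an
-- arbitrary choice of second coordinate in Fin k at every vertex, which gives
-- the factor kⁿ; fixing the root color leaves n ∸ 1 free choices.
module Submission where

open import Defs
open import Data.Fin using (Fin; quotient; remainder)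
open import Data.Fin.Patterns using (0F; 1F)
open import Data.Fin.Permutation using (↔⇒≡)
open import Data.Fin.Properties using (*↔×; 1↔⊤)
open import Data.List using (List; []; _∷_)
open import Data.List.Relation.Unary.All using (All; []; _∷_)
open import Data.Nat using (ℕ; suc; _≤_; _+_; _*_; _^_)
open import Data.Nat.Properties using (^-distribˡ-+-*)
open import Data.Product using (Σ; _×_; _,_)
open import Data.Product.Function.Dependent.Propositional using (Σ-↔)
open import Data.Product.Function.NonDependent.Propositional using (_×-↔_)
open import Data.Unit using (tt)
open import Function using (_↔_; mk↔ₛ′)
open import Function.Properties.Inverse using (↔-refl; ↔-sym; ↔-trans)
open import Relation.Binary.PropositionalEquality using (_≡_; refl; cong; sym; subst; module ≡-Reasoning)

Fin-^-+ : ∀ k a b → Fin (k * k ^ a * k ^ b) ↔ Fin (k ^ (suc a + b))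
-- `k * k ^ a` is `k ^ suc a` by definition, so the exponent law applies directly.
Fin-^-+ k a b = subst (λ N → Fin (k * k ^ a * k ^ b) ↔ Fin N)
  (sym (^-distribˡ-+-* k (suc a) b)) ↔-refl

-- Counts are read off particular enumerations. Composing these with the bijection gives one between
-- two `Fin` types, which forces equal sizes whichever enumerations were chosen.
card-× : ∀ {X Y N} ((M , _) : Finite X) ((L , _) : Finite Y) →
         X ↔ (Fin N × Y) → M ≡ N * L
card-× (_ , f) (_ , g) h =
  ↔⇒≡ (↔-trans (↔-sym f) (↔-trans h (↔-trans (↔-refl ×-↔ g) (↔-sym *↔×))))

-- `*↔×` splits a blowup color into quotient and remainder; a family that sees only the quotient
-- leaves the remainder free.
Σ-quotient : ∀ {m} k {P : Fin m → Set} →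
             Σ (Fin (m * k)) (λ p → P (quotient k p)) ↔ (Fin k × Σ (Fin m) P)
Σ-quotient {m} k {P} = ↔-trans (Σ-↔ {B = λ (i , _) → P i} *↔× ↔-refl)
  (mk↔ₛ′ (λ ((i , r) , x) → r , i , x) (λ (r , i , x) → (i , r) , x)
         (λ _ → refl) (λ _ → refl))

block-entry : ∀ {k} b (r s : Fin k) → block b r s ≡ b
block-entry 0F r s = refl
block-entry 1F r s = refl

-- A bijection rather than an equivalence, since adjacency proofs are components of the colored
-- forests being counted.
blowup-≡1F : ∀ {m} k (A : ColoringMatrix m) p q →
             (blowup k A p q ≡ 1F) ↔ (A (quotient k p) (quotient k q) ≡ 1F)
blowup-≡1F {m} k A p q = subst (λ b → (blowup k A p q ≡ 1F) ↔ (b ≡ 1F))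
  (block-entry _ (remainder {m} k p) (remainder {m} k q)) ↔-refl

-- The shape is held fixed, so that induction on it is structural and the exponent `sizes ts` is
-- determined by it.
Forest : ∀ {m} → ColoringMatrix m → Fin m → List PlaneTree → Set
Forest {m} A i ts = Σ (All (Coloring m) ts) (AreChildrenOf A i)

forest-[] : ∀ {m} (A : ColoringMatrix m) i → Forest A i [] ↔ Fin 1
forest-[] A i = ↔-trans
  (mk↔ₛ′ (λ _ → tt) (λ _ → [] , tt) (λ _ → refl) (λ { ([] , tt) → refl }))
  (↔-sym 1↔⊤)

forest-∷ : ∀ {m} (A : ColoringMatrix m) i us ts →
  Forest A i (node us ∷ ts) ↔
  Σ (Fin m) λ j → A i j ≡ 1F × Forest A j us × Forest A i ts
forest-∷ A i us ts = mk↔ₛ′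
  (λ { (node j cs ∷ ds , e , p , q) → j , e , (cs , p) , (ds , q) })
  (λ { (j , e , (cs , p) , (ds , q)) → node j cs ∷ ds , e , p , q })
  (λ { (j , e , (cs , p) , (ds , q)) → refl })
  (λ { (node j cs ∷ ds , e , p , q) → refl })

-- Induction on the shape. The color `p` lies above the forest: it acts only through its quotient,
-- and its own remainder is not counted.
forest-blowup : ∀ {m} k (A : ColoringMatrix m) p ts →
  Forest (blowup k A) p ts ↔ (Fin (k ^ sizes ts) × Forest A (quotient k p) ts)
forest-blowup k A p [] = ↔-trans (forest-[] (blowup k A) p)
  (↔-trans *↔× (↔-refl ×-↔ ↔-sym (forest-[] A (quotient k p))))
forest-blowup {m} k A p (node us ∷ ts) =
  ↔-trans (forest-∷ (blowup k A) p us ts)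
  (↔-trans (Σ-↔ ↔-refl λ {q} →
     blowup-≡1F k A p q ×-↔ (forest-blowup k A q us ×-↔ forest-blowup k A p ts))
  -- By now the summand depends on the first root's color `q` only through `quotient k q`, so the
  -- remainder of `q` splits off as `Fin k`.
  (↔-trans (Σ-quotient k {Factors})
  (↔-trans collect
  (choices ×-↔ ↔-sym (forest-∷ A i us ts)))))
  where
  i = quotient k p
  U = Fin (k ^ sizes us)
  T = Fin (k ^ sizes ts)

  Factors : Fin m → Set
  Factors j = A i j ≡ 1F × (U × Forest A j us) × (T × Forest A i ts)

  collect : (Fin k × Σ (Fin m) Factors) ↔
            (((Fin k × U) × T) × Σ (Fin m) λ j → A i j ≡ 1F × Forest A j us × Forest A i ts)
  collect = mk↔ₛ′
    (λ (r , j , e , (u , f) , (t , g)) → ((r , u) , t) , j , e , f , g)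
    (λ (((r , u) , t) , j , e , f , g) → r , j , e , (u , f) , (t , g))
    (λ _ → refl) (λ _ → refl)

  -- The three factors belong to the first root, the vertices below it, and the remaining trees.
  choices : ((Fin k × U) × T) ↔ Fin (k ^ sizes (node us ∷ ts))
  choices = ↔-trans (↔-trans (↔-sym *↔× ×-↔ ↔-refl) (↔-sym *↔×))
                    (Fin-^-+ k (sizes us) (sizes ts))

rooted↔forest : ∀ {m} (A : ColoringMatrix m) i n →
  ColoredTreeWithRoot A i (suc n) ↔ Σ (List PlaneTree) λ ts → sizes ts ≡ n × Forest A i ts
rooted↔forest A i n = mk↔ₛ′
  (λ { (node ts , refl , node _ cs , p , refl) → ts , refl , cs , p })
  (λ { (ts , refl , cs , p) → node ts , refl , node i cs , p , refl })
  (λ { (ts , refl , cs , p) → refl })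
  (λ { (node ts , refl , node _ cs , p , refl) → refl })

-- The exponent is one less than the number of vertices because `p` prescribes the root's remainder
-- too.
rooted-blowup : ∀ {m} k (A : ColoringMatrix m) p n →
  ColoredTreeWithRoot (blowup k A) p (suc n) ↔
  (Fin (k ^ n) × ColoredTreeWithRoot A (quotient k p) (suc n))
rooted-blowup k A p n =
  ↔-trans (rooted↔forest (blowup k A) p n)
  (↔-trans (Σ-↔ ↔-refl λ {ts} → ↔-refl ×-↔ forest-blowup k A p ts)
  (↔-trans collect
  (↔-refl ×-↔ ↔-sym (rooted↔forest A i n))))
  where
  i = quotient k p

  collect : (Σ (List PlaneTree) λ ts → sizes ts ≡ n × Fin (k ^ sizes ts) × Forest A i ts) ↔
            (Fin (k ^ n) × Σ (List PlaneTree) λ ts → sizes ts ≡ n × Forest A i ts)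
  -- Matching `refl` turns `k ^ sizes ts` into `k ^ n`, which no longer varies with `ts` and so
  -- leaves the sum.
  collect = mk↔ₛ′
    (λ { (ts , refl , x , f) → x , ts , refl , f })
    (λ { (x , ts , refl , f) → ts , refl , x , f })
    (λ { (x , ts , refl , f) → refl })
    (λ { (ts , refl , x , f) → refl })

tree↔rooted : ∀ {m} (A : ColoringMatrix m) n →
  ColoredTree A n ↔ Σ (Fin m) λ i → ColoredTreeWithRoot A i n
tree↔rooted A n = mk↔ₛ′
  (λ (t , e , c , p) → rootColor c , t , e , c , p , refl)
  (λ (_ , t , e , c , p , _) → t , e , c , p)
  (λ { (_ , t , e , c , p , refl) → refl })
  (λ _ → refl)

-- Summing over all root colors frees the root's remainder and supplies the factor `k` missing from
-- `k ^ n`.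
tree-blowup : ∀ {m} k (A : ColoringMatrix m) n →
  ColoredTree (blowup k A) (suc n) ↔ (Fin (k ^ suc n) × ColoredTree A (suc n))
tree-blowup {m} k A n =
  ↔-trans (tree↔rooted (blowup k A) (suc n))
  (↔-trans (Σ-↔ ↔-refl λ {p} → rooted-blowup k A p n)
  (↔-trans (Σ-quotient k {λ i → Fin (k ^ n) × ColoredTreeWithRoot A i (suc n)})
  (↔-trans collect
  (↔-sym *↔× ×-↔ ↔-sym (tree↔rooted A (suc n))))))
  where
  collect : (Fin k × Σ (Fin m) λ i → Fin (k ^ n) × ColoredTreeWithRoot A i (suc n)) ↔
            ((Fin k × Fin (k ^ n)) × Σ (Fin m) λ i → ColoredTreeWithRoot A i (suc n))
  collect = mk↔ₛ′ (λ (r , i , x , t) → (r , x) , i , t) (λ ((r , x) , i , t) → r , i , x , t)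
                  (λ _ → refl) (λ _ → refl)

treeCountWithRoot-blowup : ∀ {m} k (A : ColoringMatrix m) p n →
  treeCountWithRoot (blowup k A) p (suc n) ≡
  k ^ n * treeCountWithRoot A (quotient k p) (suc n)
treeCountWithRoot-blowup k A p n =
  card-× (finite-ColoredTreeWithRoot (blowup k A) p (suc n))
         (finite-ColoredTreeWithRoot A (quotient k p) (suc n))
         (rooted-blowup k A p n)

treeCount-blowup : ∀ {m} k (A : ColoringMatrix m) n → 1 ≤ n →
  treeCount (blowup k A) n ≡ k ^ n * treeCount A n
treeCount-blowup k A (suc n) _ =
  card-× (finite-ColoredTree (blowup k A) (suc n)) (finite-ColoredTree A (suc n))
         (tree-blowup k A n)

blowup-equivalent : ∀ {m} k (A B : ColoringMatrix m) →
  TreeColoringEquivalent A B → TreeColoringEquivalent (blowup k A) (blowup k B)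
blowup-equivalent k A B A~B n 1≤n = begin
  treeCount (blowup k A) n ≡⟨ treeCount-blowup k A n 1≤n ⟩
  k ^ n * treeCount A n    ≡⟨ cong (k ^ n *_) (A~B n 1≤n) ⟩
  k ^ n * treeCount B n    ≡⟨ treeCount-blowup k B n 1≤n ⟨
  treeCount (blowup k B) n ∎
  where open ≡-Reasoning

blowup-strictlyEquivalent : ∀ {m} k (A B : ColoringMatrix m) →
  StrictlyTreeColoringEquivalent A B →
  StrictlyTreeColoringEquivalent (blowup k A) (blowup k B)
-- The factor `k ^ n` is the same for both matrices, so the hypothesis is needed at the root color
-- `quotient k p`.
blowup-strictlyEquivalent k A B A~B (suc n) 1≤n p = begin
  treeCountWithRoot (blowup k A) p (suc n)           ≡⟨ treeCountWithRoot-blowup k A p n ⟩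
  k ^ n * treeCountWithRoot A (quotient k p) (suc n) ≡⟨ cong (k ^ n *_) (A~B (suc n) 1≤n (quotient k p)) ⟩
  k ^ n * treeCountWithRoot B (quotient k p) (suc n) ≡⟨ treeCountWithRoot-blowup k B p n ⟨
  treeCountWithRoot (blowup k B) p (suc n)           ∎
  where open ≡-Reasoning

theorem22 : (k : ℕ) → 1 ≤ k →
    ((m : ℕ) (A B : ColoringMatrix m) → TreeColoringEquivalent A B → TreeColoringEquivalent (blowup k A) (blowup k B))
    × ((m : ℕ) (A B : ColoringMatrix m) → StrictlyTreeColoringEquivalent A B → StrictlyTreeColoringEquivalent (blowup k A) (blowup k B))
    × ((m : ℕ) (A : ColoringMatrix m) (n : ℕ) → 1 ≤ n → treeCount (blowup k A) n ≡ (k ^ n) * treeCount A n)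
theorem22 k _ =
  (λ _ → blowup-equivalent k) , (λ _ → blowup-strictlyEquivalent k) , (λ _ → treeCount-blowup k)
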